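{- If $G$ is a finite simple graph with chromatic number $\chi(G)=3$, then $\mathrm{Hom}(G,K_3)$ is disconnected.
   Context: $K_3$ is the complete graph on 3 vertices. For graphs $G,H$, the homomorphism complex $\mathrm{Hom}(G,H)$ is the polyhedral complex whose cells are functions $\eta:V(G)\to 2^{V(H)}\setminus\{\varnothing\}$ such that whenever $\{x,y\}\in E(G)$ we have $\eta(x)\times\eta(y)\subseteq E(H)$; the cell $\eta$ is a product of simplices of dimension $\sum_{v}(|\eta(v)|-1)$, with face relation $\eta\subseteq\tau$ iff $\eta(v)\subseteq\tau(v)$ for all $v$. Its 0-cells are the graph homomorphisms $G\to H$. Disconnected means the (geometric realization of the) complex is nonempty and has more than one path component. -}

module Defs where

open import Level using (0ℓ)
open import Data.Nat.Base as ℕ using (ℕ)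
open import Data.Rational.Base as ℚ using (ℚ; 0ℚ; 1ℚ; ½)
import Data.Rational.Properties as ℚₚ
open import Data.Fin.Base using (Fin)
import Data.Fin.Properties as Finₚ
open import Data.Product.Base using (Σ; ∃; _×_; _,_; proj₁)
open import Data.Vec.Functional using (Vector; foldr)
open import Function.Base using (_∘_)
open import Relation.Binary.Core using (Rel)
open import Relation.Binary.Definitions using (Symmetric; Irreflexive; Decidable)
open import Relation.Binary.PropositionalEquality
  using (_≡_; _≢_; refl; sym; trans; cong; subst; subst₂)
open import Relation.Nullary.Negation using (¬_)
open import Relation.Nullary.Decidable using (¬?)
open import Relation.Unary using (Pred; _∈_; _∉_; Satisfiable)

record FiniteSimpleGraph : Set₁ where
  field
    order  : ℕ
    Adj    : Rel (Fin order) 0ℓ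
    adj?   : Decidable Adj
    symm   : Symmetric Adj
    irrefl : Irreflexive _≡_ Adj

  Vertex : Set
  Vertex = Fin order

open FiniteSimpleGraph

K : ℕ → FiniteSimpleGraph
K n = record
  { order  = n
  ; Adj    = _≢_
  ; adj?   = λ i j → ¬? (i Finₚ.≟ j)
  ; symm   = λ i≢j → i≢j ∘ sym
  ; irrefl = λ i≡j i≢j → i≢j i≡j
  }

Colourable : FiniteSimpleGraph → ℕ → Set
Colourable G k =
  Σ (Vertex G → Fin k) λ c → ∀ {x y} → Adj G x y → c x ≢ c y

HasChromaticNumber : FiniteSimpleGraph → ℕ → Set
HasChromaticNumber G k = Colourable G k × (∀ j → Colourable G j → k ℕ.≤ j)

-- Real numbers, as Cauchy sequences of rationals.  Real numbers are
-- compared with _≈_, never with _≡_.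
IsCauchy : (ℕ → ℚ) → Set
IsCauchy s = ∀ ε → 0ℚ ℚ.< ε →
  ∃ λ N → ∀ m n → N ℕ.≤ m → N ℕ.≤ n → ℚ.∣ s m ℚ.- s n ∣ ℚ.< ε

record ℝ : Set where
  constructor mkℝ
  field
    seq    : ℕ → ℚ
    cauchy : IsCauchy seq

open ℝ public

infix 4 _<_ _≤_ _≈_ ∣_-_∣<_
infixl 6 _+_

_<_ : Rel ℝ 0ℓ
x < y = ∃ λ ε → 0ℚ ℚ.< ε × ∃ λ N → ∀ n → N ℕ.≤ n → seq x n ℚ.+ ε ℚ.< seq y n

_≤_ : Rel ℝ 0ℓ
x ≤ y = ¬ (y < x)

_≈_ : Rel ℝ 0ℓ
x ≈ y = x ≤ y × y ≤ x

fromℚ : ℚ → ℝ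
fromℚ q = mkℝ (λ _ → q) λ ε 0<ε → 0 , λ _ _ _ _ →
  subst (λ r → ℚ.∣ r ∣ ℚ.< ε) (sym (ℚₚ.+-inverseʳ q)) 0<ε

0ℝ 1ℝ : ℝ
0ℝ = fromℚ 0ℚ
1ℝ = fromℚ 1ℚ

_+_ : ℝ → ℝ → ℝ
x + y = mkℝ (λ n → seq x n ℚ.+ seq y n) cauchy-+
  where
  open import Data.Nat.Properties using (≤-trans; m≤m⊔n; m≤n⊔m)
  open import Algebra.Bundles using (module CommutativeMonoid)
  open import Algebra.Properties.CommutativeSemigroup
    (CommutativeMonoid.commutativeSemigroup ℚₚ.+-0-commutativeMonoid)
    using (interchange)

  halves : ∀ ε → ε ℚ.* ½ ℚ.+ ε ℚ.* ½ ≡ ε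
  halves ε = trans (sym (ℚₚ.*-distribˡ-+ ε ½ ½)) (ℚₚ.*-identityʳ ε)

  0<half : ∀ {ε} → 0ℚ ℚ.< ε → 0ℚ ℚ.< ε ℚ.* ½
  0<half {ε} 0<ε =
    subst (ℚ._< ε ℚ.* ½) (ℚₚ.*-zeroˡ ½) (ℚₚ.*-monoˡ-<-pos ½ 0<ε)

  rearrange : ∀ a b c d →
    (a ℚ.- c) ℚ.+ (b ℚ.- d) ≡ (a ℚ.+ b) ℚ.- (c ℚ.+ d)
  rearrange a b c d = trans (interchange a (ℚ.- c) b (ℚ.- d))
    (cong ((a ℚ.+ b) ℚ.+_) (sym (ℚₚ.neg-distrib-+ c d)))

  cauchy-+ : IsCauchy (λ n → seq x n ℚ.+ seq y n)
  cauchy-+ ε 0<ε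
    with M , close-x ← cauchy x (ε ℚ.* ½) (0<half 0<ε)
       | N , close-y ← cauchy y (ε ℚ.* ½) (0<half 0<ε)
    = M ℕ.⊔ N , λ m n p q →
      subst₂ (λ a b → ℚ.∣ a ∣ ℚ.< b)
        (rearrange (seq x m) (seq y m) (seq x n) (seq y n)) (halves ε)
        (ℚₚ.≤-<-trans
          (ℚₚ.∣p+q∣≤∣p∣+∣q∣ (seq x m ℚ.- seq x n) (seq y m ℚ.- seq y n))
          (ℚₚ.+-mono-<
            (close-x m n (≤-trans (m≤m⊔n M N) p) (≤-trans (m≤m⊔n M N) q))
            (close-y m n (≤-trans (m≤n⊔m M N) p) (≤-trans (m≤n⊔m M N) q))))

∣_-_∣<_ : ℝ → ℝ → ℝ → Set
∣ x - y ∣< ε = x < y + ε × y < x + ε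

sum : ∀ {n} → Vector ℝ n → ℝ
sum = foldr _+_ 0ℝ

UnitInterval : Set
UnitInterval = Σ ℝ λ t → 0ℝ ≤ t × t ≤ 1ℝ

fromℚ-mono-≤ : ∀ {p q} → p ℚ.≤ q → fromℚ p ≤ fromℚ q
fromℚ-mono-≤ {p} {q} p≤q (ε , 0<ε , N , q+ε<p) = ℚₚ.<-irrefl refl
  (ℚₚ.<-≤-trans (ℚₚ.<-trans q<q+ε (q+ε<p N ≤-refl)) p≤q)
  where
  open import Data.Nat.Properties using (≤-refl)

  q<q+ε : q ℚ.< q ℚ.+ ε
  q<q+ε = subst (ℚ._< q ℚ.+ ε) (ℚₚ.+-identityʳ q) (ℚₚ.+-monoʳ-< q 0<ε)

0≤1 : 0ℝ ≤ 1ℝ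
0≤1 = fromℚ-mono-≤ (ℚₚ.nonNegative⁻¹ 1ℚ)

0ᴵ 1ᴵ : UnitInterval
0ᴵ = 0ℝ , fromℚ-mono-≤ ℚₚ.≤-refl , 0≤1
1ᴵ = 1ℝ , 0≤1 , fromℚ-mono-≤ ℚₚ.≤-refl

module _ (G H : FiniteSimpleGraph) where

  -- Subsets of V(H) are arbitrary predicates.  Requiring them to be
  -- decidable would be no restriction classically, but constructively a
  -- path could then run from one cell into another only by deciding at
  -- which times it lies in which.
  record Cell : Set₁ where
    field
      η        : Vertex G → Pred (Vertex H) 0ℓ
      nonempty : ∀ v → Satisfiable (η v)
      complete : ∀ {x y} → Adj G x y →
                 ∀ {a b} → a ∈ η x → b ∈ η y → Adj H a b

  open Cell

  -- Every cell η is realized as the product over v of the faces of the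
  -- standard simplex on V(H) spanned by η v; then τ contains η exactly when
  -- η v ⊆ τ v for all v.  The realization is the union of these products
  -- inside ℝ^(V(G) × V(H)), with the subspace topology (H and G are finite).
  Coordinates : Set
  Coordinates = Vertex G → Vector ℝ (order H)

  record _∈Closed_ (p : Coordinates) (c : Cell) : Set where
    field
      nonneg    : ∀ v a → 0ℝ ≤ p v a
      sum-one   : ∀ v → sum (p v) ≈ 1ℝ
      supported : ∀ v a → a ∉ η c v → p v a ≈ 0ℝ

  ∣Hom∣ : Set₁
  ∣Hom∣ = Σ Coordinates λ p → ∃ λ c → p ∈Closed c

  coord : ∣Hom∣ → Coordinates
  coord = proj₁

  _≈ₚ_ : ∣Hom∣ → ∣Hom∣ → Set
  p ≈ₚ q = ∀ v a → coord p v a ≈ coord q v a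

  -- Pointwise ε-δ continuity; as every coordinate is compared, this is
  -- continuity for the maximum metric.
  Continuous : (UnitInterval → ∣Hom∣) → Set
  Continuous γ = ∀ t ε → 0ℝ < ε → ∃ λ δ → 0ℝ < δ ×
    (∀ s → ∣ proj₁ s - proj₁ t ∣< δ →
     ∀ v a → ∣ coord (γ s) v a - coord (γ t) v a ∣< ε)

  record Path (p q : ∣Hom∣) : Set₁ where
    field
      γ          : UnitInterval → ∣Hom∣
      continuous : Continuous γ
      start      : γ 0ᴵ ≈ₚ p
      end        : γ 1ᴵ ≈ₚ q

  -- Two points in different path components; in particular the realization
  -- is nonempty.
  HomDisconnected : Set₁
  HomDisconnected = Σ ∣Hom∣ λ p → Σ ∣Hom∣ λ q → ¬ Path p q

{-# OPTIONS --safe #-}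

-- A closed walk has a winding number around the triangle K₃ under each
-- proper 3-colouring, and this number depends only on the component of the
-- colouring: two vertices of one cell give the same number.  Reversing the
-- orientation of the triangle negates it.  So if a colouring c is connected
-- to its reflection, then all winding numbers of c vanish, c lifts to a height
-- function G → ℤ whose values at adjacent vertices differ by ±1, and the
-- parity of the height is a 2-colouring of G.
--
-- To follow the winding number along a path, a colouring is read off each
-- point p of the realization by choosing at every v some a with p v a > 1/4,
-- which can be decided on rational approximations.  The winding number of
-- this choice is locally constant in time, and bisection shows that a locally
-- constant function on the unit interval takes the same value at both ends.
module Submission where

open import Defs

open import Data.Bool.Base using (true; false; if_then_else_)
open import Data.Empty using (⊥)
open import Data.Fin.Base as Fin using (Fin; zero; suc; opposite)
open import Data.Fin.Patterns using (0F; 1F; 2F)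
import Data.Fin.Properties as Finₚ
open import Data.Integer.Base as ℤ using (ℤ; +_; -[1+_]; +[1+_]; +0; 0ℤ; 1ℤ; -1ℤ)
import Data.Integer.Properties as ℤₚ
import Data.Integer.Solver as ℤSolver
open import Data.Nat.Base as ℕ using (ℕ; zero; suc; parity)
import Data.Nat.Properties as ℕₚ
open import Data.Parity.Base using (Parity; 0ℙ; 1ℙ)
open import Data.Parity.Properties using (suc-homo-⁻¹; p≢p⁻¹)
open import Data.Product.Base using (∃; _×_; _,_; proj₁; proj₂)
open import Data.Rational.Base as ℚ using (ℚ; mkℚ; 0ℚ; 1ℚ; ½)
import Data.Rational.Properties as ℚₚ
import Data.Rational.Solver as ℚSolver
import Data.Rational.Unnormalised.Base as ℚᵘ
import Data.Rational.Unnormalised.Properties as ℚᵘₚ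
open import Data.Sum.Base using (_⊎_; inj₁; inj₂)
open import Data.Vec.Functional using (Vector)
open import Effect.Monad using (RawMonad)
open import Function.Base using (_∘_)
open import Level using (0ℓ)
open import Relation.Binary.Construct.Closure.ReflexiveTransitive
  using (Star; _◅_) renaming (ε to [])
open import Relation.Binary.Core using (Rel)
open import Relation.Binary.Definitions using (DecidableEquality)
open import Relation.Binary.PropositionalEquality
open import Relation.Nullary using (¬_; Dec; yes; no; does)
open import Relation.Nullary.Decidable
  using (decidable-stable; from-yes; _→-dec_; ¬?; dec-false; ¬¬-excluded-middle)
open import Relation.Nullary.Negation using (contradiction; DoubleNegation; ¬¬-Monad)
open import Relation.Unary using (Pred; Decidable)

-- Winding numbers

step : Fin 3 → Fin 3 → ℤ
step 0F 1F = 1ℤ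
step 1F 2F = 1ℤ
step 2F 0F = 1ℤ
step 1F 0F = -1ℤ
step 2F 1F = -1ℤ
step 0F 2F = -1ℤ
step _  _  = 0ℤ

-- A vertex recoloured from a to a′ while a neighbour keeps its colour b cannot
-- pass through b, so it moves to a′ the long way round: its lift to ℤ changes
-- by −2 step a a′.
slide : Fin 3 → Fin 3 → ℤ
slide a a′ = step a a′ ℤ.+ step a a′

-- `opposite` swaps `0F` and `2F` and fixes `1F`, a reflection of the triangle.
step-opposite : ∀ a b → step (opposite a) (opposite b) ≡ ℤ.- step a b
step-opposite = from-yes (Finₚ.all? λ a → Finₚ.all? λ b →
  step (opposite a) (opposite b) ℤₚ.≟ ℤ.- step a b)

-- With three colours only one end can change: if `a ≢ a′`, then `b` and `b′` are both the third
-- colour. Exhaustive evaluation confirms that the lifts agree.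
step-slide : ∀ a b a′ b′ → a ≢ b → a ≢ b′ → a′ ≢ b → a′ ≢ b′ →
             step a b ℤ.+ slide a a′ ≡ step a′ b′ ℤ.+ slide b b′
step-slide = from-yes (Finₚ.all? λ a → Finₚ.all? λ b → Finₚ.all? λ a′ → Finₚ.all? λ b′ →
  ¬? (a Finₚ.≟ b) →-dec ¬? (a Finₚ.≟ b′) →-dec ¬? (a′ Finₚ.≟ b) →-dec ¬? (a′ Finₚ.≟ b′) →-dec
  (step a b ℤ.+ slide a a′ ℤₚ.≟ step a′ b′ ℤ.+ slide b b′))

step-±1 : ∀ a b → a ≢ b → step a b ≡ 1ℤ ⊎ step a b ≡ -1ℤ
step-±1 0F 0F a≢b = contradiction refl a≢b
step-±1 0F 1F _   = inj₁ refl
step-±1 0F 2F _   = inj₂ refl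
step-±1 1F 0F _   = inj₂ refl
step-±1 1F 1F a≢b = contradiction refl a≢b
step-±1 1F 2F _   = inj₁ refl
step-±1 2F 0F _   = inj₁ refl
step-±1 2F 1F _   = inj₂ refl
step-±1 2F 2F a≢b = contradiction refl a≢b

parity-suc : ∀ n → parity (suc n) ≢ parity n
parity-suc n eq = p≢p⁻¹ (parity (suc n)) (trans eq (sym (suc-homo-⁻¹ n)))

parity-1+ : ∀ i → parity ℤ.∣ 1ℤ ℤ.+ i ∣ ≢ parity ℤ.∣ i ∣
parity-1+ (+ n)        = parity-suc n
parity-1+ -[1+ 0 ]     = λ ()
parity-1+ -[1+ suc n ] = parity-suc (suc n) ∘ sym

parity-step : ∀ {a b} → a ≢ b → ∀ i → parity ℤ.∣ step a b ℤ.+ i ∣ ≢ parity ℤ.∣ i ∣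
parity-step {a} {b} a≢b i with step a b | step-±1 a b a≢b
... | _ | inj₁ refl = parity-1+ i
... | _ | inj₂ refl = λ eq → parity-1+ (-1ℤ ℤ.+ i)
  (trans (cong (parity ∘ ℤ.∣_∣) 1+[-1+i]≡i) (sym eq))
  where
  1+[-1+i]≡i : 1ℤ ℤ.+ (-1ℤ ℤ.+ i) ≡ i
  1+[-1+i]≡i = trans (sym (ℤₚ.+-assoc 1ℤ -1ℤ i)) (ℤₚ.+-identityˡ i)

i≡-i⇒i≡0 : ∀ i → i ≡ ℤ.- i → i ≡ 0ℤ
-- A nonzero integer and its negative have different constructors, so no other case arises.
i≡-i⇒i≡0 +0 _ = refl

least : ∀ {n} {P : Pred (Fin n) 0ℓ} → Decidable P → ∃ P →
        ∃ λ i → P i × (∀ j → P j → i Fin.≤ j)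
least {suc n} P? (k , Pk) with P? zero
... | yes P0 = zero , P0 , λ _ _ → ℕ.z≤n
least {suc n} P? (zero  , Pk) | no ¬P0 = contradiction Pk ¬P0
least {suc n} P? (suc k , Pk) | no ¬P0 with i , Pi , i≤ ← least (P? ∘ suc) (k , Pk) =
  suc i , Pi , λ where
    zero    P0 → contradiction P0 ¬P0
    (suc j) Pj → ℕ.s≤s (i≤ j Pj)

-- Winding along walks and its invariance under recolouring

module Walks (G : FiniteSimpleGraph) where
  open FiniteSimpleGraph G

  Walk : Rel Vertex 0ℓ
  Walk = Star Adj

  Colouring : Set
  Colouring = Vertex → Fin 3

  Proper : Colouring → Set
  Proper c = ∀ {x y} → Adj x y → c x ≢ c y

  winding : Colouring → ∀ {x y} → Walk x y → ℤ
  winding c []                   = 0ℤ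
  winding c (_◅_ {x} {y} _ p) = step (c x) (c y) ℤ.+ winding c p

  winding-cong : ∀ {c c′} → c ≗ c′ → ∀ {x y} (p : Walk x y) → winding c p ≡ winding c′ p
  winding-cong c≗c′ []                 = refl
  winding-cong c≗c′ (_◅_ {x} {y} _ p) =
    cong₂ ℤ._+_ (cong₂ step (c≗c′ x) (c≗c′ y)) (winding-cong c≗c′ p)

  winding-opposite : ∀ c {x y} (p : Walk x y) →
                     winding (opposite ∘ c) p ≡ ℤ.- winding c p
  winding-opposite c []                 = refl
  winding-opposite c (_◅_ {x} {y} _ p) = trans
    (cong₂ ℤ._+_ (step-opposite (c x) (c y)) (winding-opposite c p))
    (sym (ℤₚ.neg-distrib-+ (step (c x) (c y)) (winding c p)))

  -- Exactly the condition that the sets `{c v, c′ v}` form a cell of Hom(G, K₃).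
  Compatible : Colouring → Colouring → Set
  Compatible c c′ = ∀ {x y} → Adj x y →
    c x ≢ c y × c x ≢ c′ y × c′ x ≢ c y × c′ x ≢ c′ y

  -- By `step-slide` on each edge; the corrections at inner vertices telescope, leaving those at the
  -- two ends. Two walks with the same ends then share them.
  winding-slide : ∀ {c c′} → Compatible c c′ → ∀ {x y} (p : Walk x y) →
    winding c p ℤ.+ slide (c x) (c′ x) ≡ winding c′ p ℤ.+ slide (c y) (c′ y)
  winding-slide comp [] = refl
  winding-slide {c} {c′} comp (_◅_ {x} {y} {z} xy p)
    with ≢₁ , ≢₂ , ≢₃ , ≢₄ ← comp xy = begin
      (s ℤ.+ w) ℤ.+ t x     ≡⟨ swap s w (t x) ⟩
      (s ℤ.+ t x) ℤ.+ w     ≡⟨ cong (ℤ._+ w) (step-slide (c x) (c y) (c′ x) (c′ y) ≢₁ ≢₂ ≢₃ ≢₄) ⟩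
      (s′ ℤ.+ t y) ℤ.+ w    ≡⟨ ℤₚ.+-assoc s′ (t y) w ⟩
      s′ ℤ.+ (t y ℤ.+ w)    ≡⟨ cong (λ i → s′ ℤ.+ i) (trans (ℤₚ.+-comm (t y) w) (winding-slide comp p)) ⟩
      s′ ℤ.+ (w′ ℤ.+ t z)   ≡⟨ ℤₚ.+-assoc s′ w′ (t z) ⟨
      (s′ ℤ.+ w′) ℤ.+ t z   ∎
    where
    open ≡-Reasoning
    s  = step (c x) (c y)
    s′ = step (c′ x) (c′ y)
    w  = winding c p
    w′ = winding c′ p
    t : Vertex → ℤ
    t v = slide (c v) (c′ v)

    swap : ∀ i j k → (i ℤ.+ j) ℤ.+ k ≡ (i ℤ.+ k) ℤ.+ j
    swap = solve 3 (λ i j k → (i :+ j) :+ k := (i :+ k) :+ j) refl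
      where open ℤSolver.+-*-Solver

  -- The winding number of the closed walk that follows p and returns along q.
  defect : Colouring → ∀ {x y} → Walk x y → Walk x y → ℤ
  defect c p q = winding c p ℤ.- winding c q

  defect-invariant : ∀ {c c′} → Compatible c c′ → ∀ {x y} (p q : Walk x y) →
                     defect c p q ≡ defect c′ p q
  defect-invariant {c} {c′} comp {x} {y} p q = begin
    winding c p ℤ.- winding c q
      ≡⟨ cancel (winding c p) (winding c q) (slide (c x) (c′ x)) ⟨
    (winding c p ℤ.+ slide (c x) (c′ x)) ℤ.- (winding c q ℤ.+ slide (c x) (c′ x))
      ≡⟨ cong₂ ℤ._-_ (winding-slide comp p) (winding-slide comp q) ⟩
    (winding c′ p ℤ.+ slide (c y) (c′ y)) ℤ.- (winding c′ q ℤ.+ slide (c y) (c′ y))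
      ≡⟨ cancel (winding c′ p) (winding c′ q) (slide (c y) (c′ y)) ⟩
    winding c′ p ℤ.- winding c′ q ∎
    where
    open ≡-Reasoning
    cancel : ∀ i j k → (i ℤ.+ k) ℤ.- (j ℤ.+ k) ≡ i ℤ.- j
    cancel = solve 3 (λ i j k → (i :+ k) :- (j :+ k) := i :- j) refl
      where open ℤSolver.+-*-Solver

  defect-cong : ∀ {c c′} → c ≗ c′ → ∀ {x y} (p q : Walk x y) → defect c p q ≡ defect c′ p q
  defect-cong c≗c′ p q = cong₂ ℤ._-_ (winding-cong c≗c′ p) (winding-cong c≗c′ q)

  defect-opposite : ∀ c {x y} (p q : Walk x y) →
                    defect (opposite ∘ c) p q ≡ ℤ.- defect c p q
  defect-opposite c p q = trans
    (cong₂ ℤ._-_ (winding-opposite c p) (winding-opposite c q))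
    (sym (ℤₚ.neg-distrib-+ (winding c p) (ℤ.- winding c q)))

  -- From path independence to a 2-colouring

  PathIndependent : Colouring → Set
  PathIndependent c = ∀ {x y} (p q : Walk x y) → winding c p ≡ winding c q

  module _ {c} (proper : Proper c) (indep : PathIndependent c)
    (walk? : ∀ x y → Dec (Walk x y)) where

    private
      -- The root of a vertex is the least vertex of its component.
      Root : Vertex → Vertex → Set
      Root x r = Walk x r × (∀ y → Walk x y → r Fin.≤ y)

      root : ∀ x → ∃ (Root x)
      root x = least (walk? x) (x , [])

      -- Each end of an edge reaches the root of the other end, so by minimality each root is at
      -- most the other.
      root-cong : ∀ {x y} → Adj x y → proj₁ (root x) ≡ proj₁ (root y)
      root-cong {x} {y} xy with r , p , r≤ ← root x | s , q , s≤ ← root y =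
        Finₚ.≤-antisym (r≤ s (xy ◅ q)) (s≤ r (symm xy ◅ p))

      rootWalk : ∀ x → Walk x (proj₁ (root x))
      rootWalk x = proj₁ (proj₂ (root x))

      height : Vertex → ℤ
      height x = winding c (rootWalk x)

      height-step : ∀ {x y} → Adj x y → height x ≡ step (c x) (c y) ℤ.+ height y
      height-step {x} {y} xy = compare (root-cong xy) (rootWalk x) (xy ◅ rootWalk y)
        where
        compare : ∀ {r s} → r ≡ s → (p : Walk x r) (q : Walk x s) → winding c p ≡ winding c q
        compare refl = indep

      bit : Parity → Fin 2
      bit 0ℙ = 0F
      bit 1ℙ = 1F

      bit-injective : ∀ {p q} → bit p ≡ bit q → p ≡ q
      bit-injective {0ℙ} {0ℙ} _ = refl
      bit-injective {1ℙ} {1ℙ} _ = refl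

    pathIndependent⇒2-colourable : Colourable G 2
    pathIndependent⇒2-colourable = (λ x → bit (parity ℤ.∣ height x ∣)) , λ {x} {y} xy eq →
      parity-step (proper xy) (height y)
        (trans (cong (parity ∘ ℤ.∣_∣) (sym (height-step xy))) (bit-injective eq))

  -- Double negation commutes with quantification over a finite set. This avoids a search for walks,
  -- as the final goal is a contradiction.
  ¬¬walk? : DoubleNegation (∀ x y → Dec (Walk x y))
  ¬¬walk? = Finₚ.sequence ¬¬-applicative λ _ → Finₚ.sequence ¬¬-applicative λ _ →
    ¬¬-excluded-middle
    where ¬¬-applicative = RawMonad.rawApplicative ¬¬-Monad

-- Rational and real numbers

open ℚSolver.+-*-Solver using (solve; _:=_; _:+_; _:*_; :-_; con)

p+[q-p]≡q : ∀ p q → p ℚ.+ (q ℚ.- p) ≡ q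
p+[q-p]≡q = solve 2 (λ p q → p :+ (q :+ :- p) := q) refl

p≤q+r⇒p-q≤r : ∀ {p q r} → p ℚ.≤ q ℚ.+ r → p ℚ.- q ℚ.≤ r
p≤q+r⇒p-q≤r {p} {q} {r} p≤q+r = subst (p ℚ.- q ℚ.≤_)
  (solve 2 (λ q r → (q :+ r) :+ :- q := r) refl q r)
  (ℚₚ.+-monoˡ-≤ (ℚ.- q) p≤q+r)

p-q<r⇒p<q+r : ∀ {p q r} → p ℚ.- q ℚ.< r → p ℚ.< q ℚ.+ r
p-q<r⇒p<q+r {p} {q} {r} p-q<r =
  subst (ℚ._< q ℚ.+ r) (p+[q-p]≡q q p) (ℚₚ.+-monoʳ-< q p-q<r)

p<q⇒0<q-p : ∀ {p q} → p ℚ.< q → 0ℚ ℚ.< q ℚ.- p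
p<q⇒0<q-p {p} {q} p<q =
  subst (ℚ._< q ℚ.- p) (ℚₚ.+-inverseʳ p) (ℚₚ.+-monoˡ-< (ℚ.- p) p<q)

p<p+q : ∀ p {q} → 0ℚ ℚ.< q → p ℚ.< p ℚ.+ q
p<p+q p {q} 0<q = subst (ℚ._< p ℚ.+ q) (ℚₚ.+-identityʳ p) (ℚₚ.+-monoʳ-< p 0<q)

p≤∣p∣ : ∀ p → p ℚ.≤ ℚ.∣ p ∣
p≤∣p∣ p with ℚₚ.≤-total 0ℚ p
... | inj₁ 0≤p = ℚₚ.≤-reflexive (sym (ℚₚ.0≤p⇒∣p∣≡p 0≤p))
... | inj₂ p≤0 = ℚₚ.≤-trans p≤0 (ℚₚ.0≤∣p∣ p)

∣p-q∣≤r : ∀ {p q r} → p ℚ.≤ q ℚ.+ r → q ℚ.≤ p ℚ.+ r → ℚ.∣ p ℚ.- q ∣ ℚ.≤ r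
∣p-q∣≤r {p} {q} {r} p≤q+r q≤p+r with ℚₚ.∣p∣≡p∨∣p∣≡-p (p ℚ.- q)
... | inj₁ eq = subst (ℚ._≤ r) (sym eq) (p≤q+r⇒p-q≤r p≤q+r)
... | inj₂ eq = subst (ℚ._≤ r)
  (sym (trans eq (solve 2 (λ p q → :- (p :+ :- q) := q :+ :- p) refl p q)))
  (p≤q+r⇒p-q≤r q≤p+r)

½p+½p≡p : ∀ p → ½ ℚ.* p ℚ.+ ½ ℚ.* p ≡ p
½p+½p≡p = solve 1 (λ p → con ½ :* p :+ con ½ :* p := p) refl

½^_ : ℕ → ℚ
½^ zero  = 1ℚ
½^ suc n = ½ ℚ.* ½^ n

½^-halves : ∀ n → ½^ suc n ℚ.+ ½^ suc n ≡ ½^ n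
½^-halves n = ½p+½p≡p (½^ n)

0<½^ : ∀ n → 0ℚ ℚ.< ½^ n
0<½^ zero    = ℚₚ.positive⁻¹ 1ℚ
0<½^ (suc n) = ℚₚ.*-monoʳ-<-pos ½ (0<½^ n)

½^n≤1/1+n : ∀ n → ℚ.toℚᵘ (½^ n) ℚᵘ.≤ ℚᵘ.mkℚᵘ (+ 1) n
½^n≤1/1+n zero    = ℚᵘₚ.≤-refl
½^n≤1/1+n (suc n) = begin
  ℚ.toℚᵘ (½ ℚ.* ½^ n)           ≃⟨ ℚₚ.toℚᵘ-homo-* ½ (½^ n) ⟩
  ℚᵘ.½ ℚᵘ.* ℚ.toℚᵘ (½^ n)       ≤⟨ ℚᵘₚ.*-monoʳ-≤-nonNeg ℚᵘ.½ (½^n≤1/1+n n) ⟩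
  ℚᵘ.½ ℚᵘ.* ℚᵘ.mkℚᵘ (+ 1) n     ≤⟨ ℚᵘ.*≤* (ℤ.+≤+ (ℕₚ.*-monoʳ-≤ 1 (ℕ.s≤s (ℕₚ.m<m+n n ℕ.z<s)))) ⟩
  ℚᵘ.mkℚᵘ (+ 1) (suc n)         ∎
  where open ℚᵘₚ.≤-Reasoning

∃½^< : ∀ {ε} → 0ℚ ℚ.< ε → ∃ λ n → ½^ n ℚ.< ε
-- The denominator of ε is `d + 1`, so ε is at least 1/(d+1), which exceeds 1/(d+2).
∃½^< {mkℚ +[1+ p ] d _} _ = suc d , ℚₚ.toℚᵘ-cancel-< (begin-strict
  ℚ.toℚᵘ (½^ suc d)      ≤⟨ ½^n≤1/1+n (suc d) ⟩
  ℚᵘ.mkℚᵘ (+ 1) (suc d)  <⟨ ℚᵘ.*<* (ℤ.+<+ (ℕₚ.*-mono-≤ {1} {suc p} (ℕ.s≤s ℕ.z≤n) (ℕₚ.≤-refl {suc (suc d)}))) ⟩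
  ℚᵘ.mkℚᵘ +[1+ p ] d     ∎)
  where open ℚᵘₚ.≤-Reasoning
∃½^< {mkℚ (+ 0) _ _}    (ℚ.*<* (ℤ.+<+ ()))
∃½^< {mkℚ -[1+ _ ] _ _} (ℚ.*<* ())

-- Strict order on Cauchy reals

fromℚ-mono-< : ∀ {p q} → p ℚ.< q → fromℚ p < fromℚ q
fromℚ-mono-< {p} {q} p<q with m , p<m , m<q ← ℚₚ.<-dense p<q =
  m ℚ.- p , p<q⇒0<q-p p<m , 0 , λ _ _ → subst (ℚ._< q) (sym (p+[q-p]≡q p m)) m<q

<-irrefl : ∀ x → ¬ x < x
<-irrefl x (ε , 0<ε , N , x+ε<x) =
  ℚₚ.<-asym (p<p+q (seq x N) 0<ε) (x+ε<x N ℕₚ.≤-refl)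

+-mono-< : ∀ x y x′ y′ → x < x′ → y < y′ → x + y < x′ + y′
+-mono-< x y x′ y′ (ε , 0<ε , M , x<x′) (ε′ , 0<ε′ , N , y<y′) =
  ε ℚ.+ ε′ , ℚₚ.+-mono-< 0<ε 0<ε′ , M ℕ.⊔ N , λ n M⊔N≤n →
    subst (ℚ._< seq x′ n ℚ.+ seq y′ n)
      (solve 4 (λ a e b e′ → (a :+ e) :+ (b :+ e′) := (a :+ b) :+ (e :+ e′)) refl
        (seq x n) ε (seq y n) ε′)
      (ℚₚ.+-mono-< (x<x′ n (ℕₚ.≤-trans (ℕₚ.m≤m⊔n M N) M⊔N≤n))
                   (y<y′ n (ℕₚ.≤-trans (ℕₚ.m≤n⊔m M N) M⊔N≤n)))

p<x<y+p⇒0<y : ∀ {p} x y → fromℚ p < x → x < y + fromℚ p → 0ℝ < y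
p<x<y+p⇒0<y {p} x y (ε , 0<ε , M , p<x) (ε′ , 0<ε′ , N , x<y+p) =
  ε , 0<ε , M ℕ.⊔ N , λ n M⊔N≤n → begin-strict
    0ℚ ℚ.+ ε                     ≡⟨ solve 2 (λ p e → con 0ℚ :+ e := (p :+ e) :+ :- p) refl p ε ⟩
    (p ℚ.+ ε) ℚ.- p              <⟨ ℚₚ.+-monoˡ-< (ℚ.- p) (p<x n (ℕₚ.≤-trans (ℕₚ.m≤m⊔n M N) M⊔N≤n)) ⟩
    seq x n ℚ.- p                <⟨ ℚₚ.+-monoˡ-< (ℚ.- p) (p<p+q (seq x n) 0<ε′) ⟩
    (seq x n ℚ.+ ε′) ℚ.- p       <⟨ ℚₚ.+-monoˡ-< (ℚ.- p) (x<y+p n (ℕₚ.≤-trans (ℕₚ.m≤n⊔m M N) M⊔N≤n)) ⟩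
    (seq y n ℚ.+ p) ℚ.- p        ≡⟨ solve 2 (λ a p → (a :+ p) :+ :- p := a) refl (seq y n) p ⟩
    seq y n                      ∎
  where open ℚₚ.≤-Reasoning

<-+-intro : ∀ x y δ {r} N → fromℚ r < δ →
            (∀ n → N ℕ.≤ n → seq x n ℚ.≤ seq y n ℚ.+ r) → x < y + δ
<-+-intro x y δ {r} N (ε , 0<ε , M , r+ε<δ) x≤y+r =
  ε , 0<ε , M ℕ.⊔ N , λ n M⊔N≤n → begin-strict
    seq x n ℚ.+ ε               ≤⟨ ℚₚ.+-monoˡ-≤ ε (x≤y+r n (ℕₚ.≤-trans (ℕₚ.m≤n⊔m M N) M⊔N≤n)) ⟩
    (seq y n ℚ.+ r) ℚ.+ ε       ≡⟨ ℚₚ.+-assoc (seq y n) r ε ⟩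
    seq y n ℚ.+ (r ℚ.+ ε)       <⟨ ℚₚ.+-monoʳ-< (seq y n) (r+ε<δ n (ℕₚ.≤-trans (ℕₚ.m≤m⊔n M N) M⊔N≤n)) ⟩
    seq y n ℚ.+ seq δ n         ∎
  where open ℚₚ.≤-Reasoning

∃fromℚ½^< : ∀ {δ} → 0ℝ < δ → ∃ λ n → fromℚ (½^ n) < δ
∃fromℚ½^< {δ} (ε , 0<ε , M , ε<δ) with n , ½^n<ε ← ∃½^< 0<ε =
  n , ε ℚ.- ½^ n , p<q⇒0<q-p ½^n<ε , M , λ k M≤k →
    subst (ℚ._< seq δ k) (trans (ℚₚ.+-identityˡ ε) (sym (p+[q-p]≡q (½^ n) ε))) (ε<δ k M≤k)

fromℚ-cotrans : ∀ {p q} → p ℚ.< q → ∀ x → fromℚ p < x ⊎ x < fromℚ q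
fromℚ-cotrans {p} {q} p<q x = decide
  where
  d = q ℚ.- p
  -- A quarter of the gap: `a` is compared with the midpoint `p + 2ε`, later terms stray from `a` by
  -- less than ε, and another ε witnesses strictness.
  ε = ½ ℚ.* (½ ℚ.* d)

  0<ε : 0ℚ ℚ.< ε
  0<ε = ℚₚ.*-monoʳ-<-pos ½ (ℚₚ.*-monoʳ-<-pos ½ (p<q⇒0<q-p p<q))

  p+4ε≡q : p ℚ.+ ε ℚ.+ ε ℚ.+ ε ℚ.+ ε ≡ q
  p+4ε≡q = begin
    p ℚ.+ ε ℚ.+ ε ℚ.+ ε ℚ.+ ε
      ≡⟨ solve 2 (λ p e → p :+ e :+ e :+ e :+ e := p :+ ((e :+ e) :+ (e :+ e))) refl p ε ⟩
    p ℚ.+ ((ε ℚ.+ ε) ℚ.+ (ε ℚ.+ ε))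
      ≡⟨ cong (λ h → p ℚ.+ (h ℚ.+ h)) (½p+½p≡p (½ ℚ.* d)) ⟩
    p ℚ.+ (½ ℚ.* d ℚ.+ ½ ℚ.* d)
      ≡⟨ cong (p ℚ.+_) (½p+½p≡p d) ⟩
    p ℚ.+ d
      ≡⟨ p+[q-p]≡q p q ⟩
    q ∎
    where open ≡-Reasoning

  N = proj₁ (cauchy x ε 0<ε)
  a = seq x N

  close : ∀ m n → N ℕ.≤ m → N ℕ.≤ n → seq x m ℚ.< seq x n ℚ.+ ε
  close m n N≤m N≤n = p-q<r⇒p<q+r
    (ℚₚ.≤-<-trans (p≤∣p∣ (seq x m ℚ.- seq x n)) (proj₂ (cauchy x ε 0<ε) m n N≤m N≤n))

  open ℚₚ.≤-Reasoning

  decide : fromℚ p < x ⊎ x < fromℚ q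
  decide with ℚₚ.≤-total a (p ℚ.+ ε ℚ.+ ε)
  ... | inj₁ a≤p+2ε = inj₂ (ε , 0<ε , N , λ n N≤n → begin-strict
    seq x n ℚ.+ ε                 <⟨ ℚₚ.+-monoˡ-< ε (close n N N≤n ℕₚ.≤-refl) ⟩
    a ℚ.+ ε ℚ.+ ε                 ≤⟨ ℚₚ.+-monoˡ-≤ ε (ℚₚ.+-monoˡ-≤ ε a≤p+2ε) ⟩
    p ℚ.+ ε ℚ.+ ε ℚ.+ ε ℚ.+ ε     ≡⟨ p+4ε≡q ⟩
    q                             ∎)
  ... | inj₂ p+2ε≤a = inj₁ (ε , 0<ε , N , λ n N≤n → begin-strict
    p ℚ.+ ε                       ≡⟨ solve 2 (λ p e → p :+ e := (p :+ e :+ e) :+ :- e) refl p ε ⟩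
    (p ℚ.+ ε ℚ.+ ε) ℚ.- ε         ≤⟨ ℚₚ.+-monoˡ-≤ (ℚ.- ε) p+2ε≤a ⟩
    a ℚ.- ε                       <⟨ ℚₚ.+-monoˡ-< (ℚ.- ε) (close N n ℕₚ.≤-refl N≤n) ⟩
    (seq x n ℚ.+ ε) ℚ.- ε         ≡⟨ solve 2 (λ a e → (a :+ e) :+ :- e := a) refl (seq x n) ε ⟩
    seq x n                       ∎)

-- Bisection

module _ {A : Set} (_≟_ : DecidableEquality A) (f : UnitInterval → A)
  (locally-constant : ∀ t → ∃ λ δ → 0ℝ < δ ×
    (∀ s → ∣ proj₁ s - proj₁ t ∣< δ → f s ≡ f t)) where

  private
    -- The proofs that a time lies in the interval may differ, and `f` could depend on them; local
    -- constancy at distance zero rules this out.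
    f-cong : ∀ s t → proj₁ s ≡ proj₁ t → f s ≡ f t
    f-cong s@(x , _) t@(.x , _) refl with δ , 0<δ , const ← locally-constant t =
      const s (x<x+δ , x<x+δ)
      where
      x<x+δ : x < x + δ
      x<x+δ = <-+-intro x x δ {0ℚ} 0 0<δ λ n _ →
        ℚₚ.≤-reflexive (sym (ℚₚ.+-identityʳ (seq x n)))

    point : ∀ q → 0ℚ ℚ.≤ q × q ℚ.≤ 1ℚ → UnitInterval
    point q (0≤q , q≤1) = fromℚ q , fromℚ-mono-≤ 0≤q , fromℚ-mono-≤ q≤1

    record Bracket (n : ℕ) : Set where
      field
        lo hi : ℚ
        lo∈   : 0ℚ ℚ.≤ lo × lo ℚ.≤ 1ℚ
        hi∈   : 0ℚ ℚ.≤ hi × hi ℚ.≤ 1ℚ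
        width : hi ≡ lo ℚ.+ ½^ n
        at-lo : f (point lo lo∈) ≡ f 0ᴵ
        at-hi : f (point hi hi∈) ≢ f 0ᴵ

    open Bracket

    mid : ∀ {n} → Bracket n → ℚ
    mid {n} b = lo b ℚ.+ ½^ suc n

    lo≤mid : ∀ {n} (b : Bracket n) → lo b ℚ.≤ mid b
    lo≤mid {n} b = ℚₚ.<⇒≤ (p<p+q (lo b) (0<½^ (suc n)))

    mid+½^≡hi : ∀ {n} (b : Bracket n) → hi b ≡ mid b ℚ.+ ½^ suc n
    mid+½^≡hi {n} b = begin
      hi b                                   ≡⟨ width b ⟩
      lo b ℚ.+ ½^ n                          ≡⟨ cong (lo b ℚ.+_) (½^-halves n) ⟨
      lo b ℚ.+ (½^ suc n ℚ.+ ½^ suc n)       ≡⟨ ℚₚ.+-assoc (lo b) _ _ ⟨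
      mid b ℚ.+ ½^ suc n                     ∎
      where open ≡-Reasoning

    mid≤hi : ∀ {n} (b : Bracket n) → mid b ℚ.≤ hi b
    mid≤hi {n} b = subst (mid b ℚ.≤_) (sym (mid+½^≡hi b))
      (ℚₚ.<⇒≤ (p<p+q (mid b) (0<½^ (suc n))))

    mid∈ : ∀ {n} (b : Bracket n) → 0ℚ ℚ.≤ mid b × mid b ℚ.≤ 1ℚ
    mid∈ b = ℚₚ.≤-trans (proj₁ (lo∈ b)) (lo≤mid b)
           , ℚₚ.≤-trans (mid≤hi b) (proj₂ (hi∈ b))

    bisectBy : ∀ {n} (b : Bracket n) → Dec (f (point (mid b) (mid∈ b)) ≡ f 0ᴵ) →
               ∃ λ (b′ : Bracket (suc n)) → lo b ℚ.≤ lo b′ × hi b′ ℚ.≤ hi b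
    bisectBy b (yes fmid≡) = record
      { lo = mid b ; hi = hi b ; lo∈ = mid∈ b ; hi∈ = hi∈ b
      ; width = mid+½^≡hi b ; at-lo = fmid≡ ; at-hi = at-hi b
      } , lo≤mid b , ℚₚ.≤-refl
    bisectBy b (no fmid≢) = record
      { lo = lo b ; hi = mid b ; lo∈ = lo∈ b ; hi∈ = mid∈ b
      ; width = refl ; at-lo = at-lo b ; at-hi = fmid≢
      } , ℚₚ.≤-refl , mid≤hi b

    bisect : ∀ {n} (b : Bracket n) →
             ∃ λ (b′ : Bracket (suc n)) → lo b ℚ.≤ lo b′ × hi b′ ℚ.≤ hi b
    bisect b = bisectBy b (f (point (mid b) (mid∈ b)) ≟ f 0ᴵ)

    module Bisection (f0≢f1 : f 0ᴵ ≢ f 1ᴵ) where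

      bracket : ∀ n → Bracket n
      bracket zero = record
        { lo = 0ℚ ; hi = 1ℚ
        ; lo∈ = ℚₚ.≤-refl , ℚₚ.nonNegative⁻¹ 1ℚ
        ; hi∈ = ℚₚ.nonNegative⁻¹ 1ℚ , ℚₚ.≤-refl
        ; width = refl
        ; at-lo = f-cong _ _ refl
        ; at-hi = λ f1≡f0 → f0≢f1 (trans (sym f1≡f0) (f-cong _ _ refl))
        }
      bracket (suc n) = proj₁ (bisect (bracket n))

      l u : ℕ → ℚ
      l n = lo (bracket n)
      u n = hi (bracket n)

      l≤u : ∀ n → l n ℚ.≤ u n
      l≤u n = subst (l n ℚ.≤_) (sym (width (bracket n))) (ℚₚ.<⇒≤ (p<p+q (l n) (0<½^ n)))

      nested : ∀ {m n} → m ℕ.≤′ n → l m ℚ.≤ l n × u n ℚ.≤ u m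
      nested ℕ.≤′-refl = ℚₚ.≤-refl , ℚₚ.≤-refl
      nested {m} {suc n} (ℕ.≤′-step m≤n) =
          ℚₚ.≤-trans (proj₁ (nested m≤n)) (proj₁ (proj₂ (bisect (bracket n))))
        , ℚₚ.≤-trans (proj₂ (proj₂ (bisect (bracket n)))) (proj₂ (nested m≤n))

      l-mono : ∀ {m n} → m ℕ.≤ n → l m ℚ.≤ l n
      l-mono m≤n = proj₁ (nested (ℕₚ.≤⇒≤′ m≤n))

      l≤uN : ∀ {m n} → m ℕ.≤ n → l n ℚ.≤ u m
      l≤uN {m} {n} m≤n = ℚₚ.≤-trans (l≤u n) (proj₂ (nested (ℕₚ.≤⇒≤′ m≤n)))

      -- From `N` on, all lower ends lie in bracket `N`, which has length `½^ N`. This gives both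
      -- the Cauchy property and the distance to the limit.
      l≤l+½^ : ∀ {N m n} → N ℕ.≤ m → N ℕ.≤ n → l m ℚ.≤ l n ℚ.+ ½^ N
      l≤l+½^ {N} {m} {n} N≤m N≤n = begin
        l m              ≤⟨ l≤uN N≤m ⟩
        u N              ≡⟨ width (bracket N) ⟩
        l N ℚ.+ ½^ N     ≤⟨ ℚₚ.+-monoˡ-≤ (½^ N) (l-mono N≤n) ⟩
        l n ℚ.+ ½^ N     ∎
        where open ℚₚ.≤-Reasoning

      l-cauchy : IsCauchy l
      l-cauchy ε 0<ε with N , ½^N<ε ← ∃½^< 0<ε = N , λ m n N≤m N≤n →
        ℚₚ.≤-<-trans (∣p-q∣≤r (l≤l+½^ N≤m N≤n) (l≤l+½^ N≤n N≤m)) ½^N<ε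

      limit : UnitInterval
      limit = mkℝ l l-cauchy
        , (λ (ε , 0<ε , N , l+ε<0) → ℚₚ.<-irrefl refl (ℚₚ.≤-<-trans
            (proj₁ (lo∈ (bracket N))) (ℚₚ.<-trans (p<p+q (l N) 0<ε) (l+ε<0 N ℕₚ.≤-refl))))
        , (λ (ε , 0<ε , N , 1+ε<l) → ℚₚ.<-irrefl refl (ℚₚ.<-≤-trans
            (ℚₚ.<-trans (p<p+q 1ℚ 0<ε) (1+ε<l N ℕₚ.≤-refl)) (proj₂ (lo∈ (bracket N)))))

      module _ {N δ} (½^N<δ : fromℚ (½^ N) < δ) where

        lo-near : ∣ fromℚ (l N) - proj₁ limit ∣< δ
        lo-near =
            <-+-intro (fromℚ (l N)) (proj₁ limit) δ {½^ N} N ½^N<δ (λ _ → l≤l+½^ ℕₚ.≤-refl)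
          , <-+-intro (proj₁ limit) (fromℚ (l N)) δ {½^ N} N ½^N<δ (λ _ N≤n → l≤l+½^ N≤n ℕₚ.≤-refl)

        hi-near : ∣ fromℚ (u N) - proj₁ limit ∣< δ
        hi-near =
            <-+-intro (fromℚ (u N)) (proj₁ limit) δ {½^ N} N ½^N<δ (λ n N≤n →
              subst (ℚ._≤ l n ℚ.+ ½^ N) (sym (width (bracket N)))
                (ℚₚ.+-monoˡ-≤ (½^ N) (l-mono N≤n)))
          , <-+-intro (proj₁ limit) (fromℚ (u N)) δ {½^ N} N ½^N<δ (λ n N≤n →
              ℚₚ.≤-trans (l≤uN N≤n) (ℚₚ.<⇒≤ (p<p+q (u N) (0<½^ N))))

        lo≡hi : (∀ t → ∣ proj₁ t - proj₁ limit ∣< δ → f t ≡ f limit) →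
                f (point (l N) (lo∈ (bracket N))) ≡ f (point (u N) (hi∈ (bracket N)))
        lo≡hi const = trans (const _ lo-near) (sym (const _ hi-near))

      -- A small enough bracket lies wholly in the neighbourhood of `limit` on which `f` is
      -- constant, yet `f` separates its ends.
      impossible : ⊥
      impossible =
        let δ , 0<δ , const = locally-constant limit
            N , ½^N<δ       = ∃fromℚ½^< {δ} 0<δ
        in at-hi (bracket N) (trans (sym (lo≡hi {N} {δ} ½^N<δ const)) (at-lo (bracket N)))

  locally-constant⇒constant : f 0ᴵ ≡ f 1ᴵ
  locally-constant⇒constant = decidable-stable (f 0ᴵ ≟ f 1ᴵ) Bisection.impossible

-- The realization of Hom(G, K₃)

indicator : ∀ {n} → Fin n → Vector ℝ n
indicator i j = if does (i Finₚ.≟ j) then 1ℝ else 0ℝ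

indicator-nonneg : ∀ {n} (i j : Fin n) → 0ℝ ≤ indicator i j
indicator-nonneg i j with does (i Finₚ.≟ j)
... | true  = 0≤1
... | false = <-irrefl 0ℝ

indicator-off : ∀ {n} {i j : Fin n} → i ≢ j → indicator i j ≡ 0ℝ
indicator-off {i = i} {j} i≢j rewrite dec-false (i Finₚ.≟ j) i≢j = refl

indicator-sum : ∀ i → sum (indicator {3} i) ≈ 1ℝ
indicator-sum 0F = <-irrefl 1ℝ , <-irrefl 1ℝ
indicator-sum 1F = <-irrefl 1ℝ , <-irrefl 1ℝ
indicator-sum 2F = <-irrefl 1ℝ , <-irrefl 1ℝ

¼ : ℚ
¼ = + 1 ℚ./ 4

0<¼ : 0ℝ < fromℚ ¼
0<¼ = fromℚ-mono-< (ℚₚ.positive⁻¹ ¼)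

¼<⇒0< : ∀ x → fromℚ ¼ < x → 0ℝ < x
¼<⇒0< x (ε , 0<ε , N , ¼+ε<x) = ε , 0<ε , N , λ n N≤n →
  ℚₚ.<-trans (ℚₚ.+-monoˡ-< ε (ℚₚ.positive⁻¹ ¼)) (¼+ε<x n N≤n)

heavy : (x : Vector ℝ 3) → 1ℝ ≤ sum x → ∃ λ a → fromℚ ¼ < x a
heavy x 1≤sum = pick (cut 0F) (cut 1F) (cut 2F)
  where
  -- Above 1/4, so that `fromℚ-cotrans` applies, and below 1/3, so that three weights under `q`
  -- cannot sum to 1.
  q = + 3 ℚ./ 10

  cut : ∀ a → fromℚ ¼ < x a ⊎ x a < fromℚ q
  cut a = fromℚ-cotrans (from-yes (¼ ℚₚ.<? q)) (x a)

  pick : fromℚ ¼ < x 0F ⊎ x 0F < fromℚ q → fromℚ ¼ < x 1F ⊎ x 1F < fromℚ q →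
         fromℚ ¼ < x 2F ⊎ x 2F < fromℚ q → ∃ λ a → fromℚ ¼ < x a
  pick (inj₁ big) _ _ = 0F , big
  pick _ (inj₁ big) _ = 1F , big
  pick _ _ (inj₁ big) = 2F , big
  -- 3 · 3/10 + 1/10 = 1, where the 1/10 dominates the 0ℝ that ends the sum.
  pick (inj₂ small₀) (inj₂ small₁) (inj₂ small₂) = contradiction
    (+-mono-< (x 0F) (x 1F + (x 2F + 0ℝ)) (fromℚ q) (fromℚ q + (fromℚ q + fromℚ (+ 1 ℚ./ 10))) small₀
      (+-mono-< (x 1F) (x 2F + 0ℝ) (fromℚ q) (fromℚ q + fromℚ (+ 1 ℚ./ 10)) small₁
        (+-mono-< (x 2F) 0ℝ (fromℚ q) (fromℚ (+ 1 ℚ./ 10)) small₂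
          (fromℚ-mono-< (ℚₚ.positive⁻¹ (+ 1 ℚ./ 10))))))
    1≤sum

-- Colourings read off points of the realization

module Realization (G : FiniteSimpleGraph) where
  open FiniteSimpleGraph G
  open Walks G

  Point : Set₁
  Point = ∣Hom∣ G (K 3)

  PositiveAt : Point → Colouring → Set
  PositiveAt p c = ∀ v → 0ℝ < coord G (K 3) p v (c v)

  -- Colours of positive weight belong to the cell that carries `p`, and `complete` separates them
  -- across an edge. Membership is only known up to double negation, which suffices for a negative
  -- conclusion.
  positive⇒apart : ∀ p {c c′} → PositiveAt p c → PositiveAt p c′ →
                   ∀ {x y} → Adj x y → c x ≢ c′ y
  positive⇒apart (p , cell , p∈) {c} {c′} c>0 c′>0 {x} {y} xy eq =
    inCell x (c x) (c>0 x) λ cx∈ → inCell y (c′ y) (c′>0 y) λ c′y∈ →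
      Cell.complete cell xy cx∈ c′y∈ eq
    where
    inCell : ∀ v a → 0ℝ < p v a → DoubleNegation (Cell.η cell v a)
    inCell v a 0<pva a∉ = proj₁ (_∈Closed_.supported p∈ v a a∉) 0<pva

  positive⇒compatible : ∀ p {c c′} → PositiveAt p c → PositiveAt p c′ → Compatible c c′
  positive⇒compatible p c>0 c′>0 xy =
      positive⇒apart p c>0 c>0 xy , positive⇒apart p c>0 c′>0 xy
    , positive⇒apart p c′>0 c>0 xy , positive⇒apart p c′>0 c′>0 xy

  select : Point → Colouring
  select (p , _ , p∈) v = proj₁ (heavy (p v) (proj₂ (_∈Closed_.sum-one p∈ v)))

  select-heavy : ∀ p v → fromℚ ¼ < coord G (K 3) p v (select p v)
  select-heavy (p , _ , p∈) v = proj₂ (heavy (p v) (proj₂ (_∈Closed_.sum-one p∈ v)))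

  select-positive : ∀ p → PositiveAt p (select p)
  select-positive p v = ¼<⇒0< (coord G (K 3) p v (select p v)) (select-heavy p v)

  vertex : ∀ c → Proper c → Point
  vertex c proper = (λ v → indicator (c v))
    , record { η = λ v → c v ≡_ ; nonempty = λ v → c v , refl
             ; complete = λ { xy refl refl → proper xy } }
    , record { nonneg = λ v → indicator-nonneg (c v) ; sum-one = λ v → indicator-sum (c v)
             ; supported = λ v a cv≢a → subst (_≈ 0ℝ) (sym (indicator-off cv≢a))
                 (<-irrefl 0ℝ , <-irrefl 0ℝ) }

  -- Although `select` depends on the approximating sequences, at a vertex only one colour has
  -- positive weight, so the choice is forced.
  select-vertex : ∀ {c} (proper : Proper c) p → _≈ₚ_ G (K 3) p (vertex c proper) →
                  select p ≗ c
  select-vertex {c} proper p p≈c v = decidable-stable (select p v Finₚ.≟ c v) λ s≢c →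
    proj₁ (subst (coord G (K 3) p v (select p v) ≈_) (indicator-off (s≢c ∘ sym))
             (p≈c v (select p v)))
      (select-positive p v)

  path⇒defect≡ : ∀ {c c′} (proper : Proper c) (proper′ : Proper c′) →
    Path G (K 3) (vertex c proper) (vertex c′ proper′) →
    ∀ {x y} (p q : Walk x y) → defect c p q ≡ defect c′ p q
  path⇒defect≡ {c} {c′} proper proper′ path p q = begin
    defect c p q                    ≡⟨ defect-cong (select-vertex proper (γ 0ᴵ) start) p q ⟨
    defect (select (γ 0ᴵ)) p q      ≡⟨ locally-constant⇒constant ℤₚ._≟_
                                         (λ t → defect (select (γ t)) p q) locally-constant ⟩
    defect (select (γ 1ᴵ)) p q      ≡⟨ defect-cong (select-vertex proper′ (γ 1ᴵ) end) p q ⟩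
    defect c′ p q                   ∎
    where
    open Path path
    open ≡-Reasoning

    locally-constant : ∀ t → ∃ λ δ → 0ℝ < δ × (∀ s → ∣ proj₁ s - proj₁ t ∣< δ →
      defect (select (γ s)) p q ≡ defect (select (γ t)) p q)
    locally-constant t =
      -- A colour selected at `s` weighs more than 1/4 there, hence is still positive at `t`. Both
      -- selections are thus positive at `γ t` and compatible through its cell.
      let δ , 0<δ , close = continuous t (fromℚ ¼) 0<¼
      in δ , 0<δ , λ s s-near-t → defect-invariant
           (positive⇒compatible (γ t)
             (λ v → p<x<y+p⇒0<y {¼} (coord G (K 3) (γ s) v (select (γ s) v))
                      (coord G (K 3) (γ t) v (select (γ s) v))
                      (select-heavy (γ s) v) (proj₁ (close s s-near-t v (select (γ s) v))))
             (select-positive (γ t)))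
           p q

-- Separating a colouring from its reflection

theorem4p1 : (G : FiniteSimpleGraph) → HasChromaticNumber G 3 → HomDisconnected G (K 3)
theorem4p1 G ((c , proper) , minimal) =
  vertex c proper , vertex (opposite ∘ c) opposite-proper , λ path →
    ¬¬walk? λ walk? → contradiction
      -- A 2-colouring turns minimality of the chromatic number into `3 ≤ 2`.
      (minimal 2 (pathIndependent⇒2-colourable proper (independent path) walk?))
      (ℕₚ.<⇒≱ ℕₚ.≤-refl)
  where
  open Walks G
  open Realization G

  opposite-proper : Proper (opposite ∘ c)
  opposite-proper xy eq = proper xy
    (trans (sym (Finₚ.opposite-involutive _)) (trans (cong opposite eq) (Finₚ.opposite-involutive _)))

  independent : Path G (K 3) (vertex c proper) (vertex (opposite ∘ c) opposite-proper) →
                PathIndependent c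
  independent path p q = ℤₚ.i-j≡0⇒i≡j (winding c p) (winding c q)
    (i≡-i⇒i≡0 (defect c p q)
      (trans (path⇒defect≡ proper opposite-proper path p q) (defect-opposite c p q)))
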